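{- Let $G$ be a finite simple graph with at least one vertex. For every proper coloring $c:V(G)\to[\chi(G)]$, every critical set $S$ for $(G,c)$ satisfies $|S|\le |V(G)|-1$.
   Context: $[k]=\{1,\dots,k\}$ and $\chi(G)$ is the chromatic number of $G=(V,E)$. For a proper coloring $c:V\to[\chi(G)]$, a determining set for $(G,c)$ is a set $S\subseteq V$ such that for every proper coloring $c':V\to[\chi(G)]$ of $G$, if $c'|_S=c|_S$ then $c'=c$ on all of $V$. A critical set for $(G,c)$ is a determining set for $(G,c)$ that is minimal under inclusion. -}

module Defs where

open import Data.Empty using (⊥-elim)
open import Data.Fin.Base using (Fin; finToFun; funToFin)
open import Data.Fin.Properties using (any?; all?; finToFun-funToFin; _≟_)
open import Data.Fin.Subset using (Subset; _∈_; _⊂_)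
open import Data.Nat.Base using (ℕ; zero; suc; _≤_; z≤n; s≤s; _^_)
open import Data.Product using (∃; _×_; _,_; proj₁; proj₂)
open import Function.Base using (id; _∘_)
open import Level using (0ℓ)
open import Relation.Binary.Core using (Rel)
open import Relation.Binary.Definitions using (Symmetric; Irreflexive)
import Relation.Binary.Definitions as B
open import Relation.Binary.PropositionalEquality
  using (_≡_; _≢_; _≗_; trans; sym)
open import Relation.Nullary using (¬_; Dec; yes; no; ¬?; _→-dec_)
open import Relation.Nullary.Decidable using (map′)
open import Relation.Unary using (Pred; Decidable)

-- Adjacency is decidable, as it is classically for any graph.
record Graph (n : ℕ) : Set₁ where
  infix 4 _~_
  field
    _~_      : Rel (Fin n) 0ℓ
    ~-sym    : Symmetric _~_
    ~-irrefl : Irreflexive _≡_ _~_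
    _~?_     : B.Decidable _~_

open Graph public using () renaming (_~_ to Adj; _~?_ to adj?)

Proper : ∀ {n k} → Graph n → (Fin n → Fin k) → Set
Proper G c = ∀ u v → Adj G u v → c u ≢ c v

Colorable : ∀ {n} → Graph n → ℕ → Set
Colorable {n} G k = ∃ λ (c : Fin n → Fin k) → Proper G c

IsChromaticNumber : ∀ {n} → Graph n → ℕ → Set
IsChromaticNumber G k = Colorable G k × (∀ j → Colorable G j → k ≤ j)

proper? : ∀ {n k} (G : Graph n) (c : Fin n → Fin k) → Dec (Proper G c)
proper? G c = all? λ u → all? λ v → adj? G u v →-dec ¬? (c u ≟ c v)

-- Colorings are enumerated through their codes in Fin (k ^ n).
colorable? : ∀ {n} (G : Graph n) → Decidable (Colorable G)
colorable? {n} G k = map′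
  (λ (i , p) → finToFun i , p)
  (λ (c , p) → funToFin c , λ u v uv e →
     p u v uv (trans (sym (finToFun-funToFin c u))
                     (trans e (finToFun-funToFin c v))))
  (any? {n = k ^ n} λ i → proper? G (finToFun {k} {n} i))

least : ∀ {p} {P : Pred ℕ p} → Decidable P → ∀ k → P k →
        ∃ λ m → P m × (∀ j → P j → m ≤ j)
least P? k pk with P? 0
least P? k       pk | yes p0 = 0 , p0 , λ _ _ → z≤n
least P? zero    pk | no ¬p0 = ⊥-elim (¬p0 pk)
least P? (suc k) pk | no ¬p0 with least (P? ∘ suc) k pk
... | m , pm , min = suc m , pm , λ where
  zero    p0 → ⊥-elim (¬p0 p0)
  (suc j) pj → s≤s (min j pj)

chromatic : ∀ {n} (G : Graph n) → ∃ (IsChromaticNumber G)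
chromatic {n} G = least (colorable? G) n
  (id , λ u v uv u≡v → Graph.~-irrefl G u≡v uv)

χ : ∀ {n} → Graph n → ℕ
χ G = proj₁ (chromatic G)

χ-isChromaticNumber : ∀ {n} (G : Graph n) → IsChromaticNumber G (χ G)
χ-isChromaticNumber G = proj₂ (chromatic G)

-- Colorings are compared pointwise, since function extensionality is
-- not available.
Determining : ∀ {n} (G : Graph n) → (Fin n → Fin (χ G)) → Subset n → Set
Determining {n} G c S =
  ∀ (c′ : Fin n → Fin (χ G)) → Proper G c′ →
  (∀ {v} → v ∈ S → c′ v ≡ c v) → c′ ≗ c

Critical : ∀ {n} (G : Graph n) → (Fin n → Fin (χ G)) → Subset n → Set
Critical G c S =
  Determining G c S × (∀ T → T ⊂ S → ¬ Determining G c T)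

{-# OPTIONS --safe #-}
-- In a coloring with the fewest colors some vertex sees every color other than
-- its own: otherwise each vertex of one color class could be moved to a color
-- absent from its neighbourhood, which eliminates that color.  The color of
-- such a vertex is forced by the others, so the full vertex set is never a
-- minimal determining set.
module Submission where

open import Defs
open import Data.Fin.Base using (Fin; zero; punchOut)
open import Data.Fin.Properties using (any?; all?; punchOut-injective; _≟_)
open import Data.Fin.Subset using (Subset; ∣_∣; ⊤; _-_)
open import Data.Fin.Subset.Properties
  using (∣p∣≤n; ∣p∣≡n⇒p≡⊤; ∈⊤; x∈p⇒p-x⊂p; x∈p∧x≢y⇒x∈p-y)
open import Data.Nat.Base using (ℕ; NonZero; _≤_; _∸_; zero; suc; s≤s⁻¹)
open import Data.Nat.Properties using (1+n≰n; ≤∧≢⇒<)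
import Data.Nat.Properties as ℕ
open import Data.Product using (∃; _×_; _,_; proj₁; proj₂)
open import Relation.Binary.PropositionalEquality
  using (_≡_; _≢_; refl; sym; trans; ≢-sym)
open import Relation.Nullary
  using (¬_; yes; no; ¬?; contradiction; _×-dec_; _→-dec_)
open import Relation.Nullary.Decidable using (decidable-stable)
open import Relation.Unary using (Decidable)

-- For proper `c`, these are the colors to which `v` alone can be moved with the coloring staying
-- proper.
FreeColor : ∀ {n k} → Graph n → (Fin n → Fin k) → Fin n → Fin k → Set
FreeColor G c v d = d ≢ c v × (∀ u → Adj G v u → d ≢ c u)

freeColor? : ∀ {n k} (G : Graph n) (c : Fin n → Fin k) v →
             Decidable (FreeColor G c v)
freeColor? G c v d =
  ¬? (d ≟ c v) ×-dec all? λ u → adj? G v u →-dec ¬? (d ≟ c u)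

unused⇒colorable : ∀ {n k} (G : Graph n) (c : Fin n → Fin (suc k)) → Proper G c →
                   ∀ a → (∀ v → a ≢ c v) → Colorable G k
unused⇒colorable G c proper a unused =
  (λ v → punchOut (unused v)) ,
  λ u v u~v eq → proper u v u~v (punchOut-injective (unused u) (unused v) eq)

module _ {n k} (G : Graph n) (c : Fin n → Fin k) (proper : Proper G c)
         (free : ∀ v → ∃ (FreeColor G c v)) (a : Fin k) where

  recolor : Fin n → Fin k
  recolor v with a ≟ c v
  ... | yes _ = proj₁ (free v)
  ... | no  _ = c v

  -- The class of `a` can be moved all at once because it is independent: each moved vertex has only
  -- unmoved neighbors, and its free color avoids their colors.
  recolor-proper : Proper G recolor
  recolor-proper u v u~v with a ≟ c u | a ≟ c v
  ... | yes a≡cu | yes a≡cv = contradiction (trans (sym a≡cu) a≡cv) (proper u v u~v)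
  ... | yes _    | no  _    = proj₂ (proj₂ (free u)) v u~v
  ... | no  _    | yes _    = ≢-sym (proj₂ (proj₂ (free v)) u (Graph.~-sym G u~v))
  ... | no  _    | no  _    = proper u v u~v

  recolor-unused : ∀ v → a ≢ recolor v
  recolor-unused v with a ≟ c v
  -- The condition `d ≢ c v` in `FreeColor` prevents a moved vertex from receiving `a` again.
  ... | yes a≡cv = λ a≡d → proj₁ (proj₂ (free v)) (trans (sym a≡d) a≡cv)
  ... | no  a≢cv = a≢cv

∃-noFreeColor : ∀ {n k} (G : Graph n) → (∀ j → Colorable G j → k ≤ j) →
                (c : Fin n → Fin k) → Proper G c → Fin n →
                ∃ λ v → ¬ ∃ (FreeColor G c v)
-- A vertex has a color, so `Fin k` is inhabited.
∃-noFreeColor {k = zero} G min c proper v with () ← c v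
∃-noFreeColor {k = suc k} G min c proper _
  with any? (λ v → ¬? (any? (freeColor? G c v)))
... | yes found = found
-- Any color could be eliminated; `zero` is one that `Fin (suc k)` always has. Minimality then gives
-- `suc k ≤ k`.
... | no  none  = contradiction
  (min k (unused⇒colorable G (recolor G c proper free zero)
    (recolor-proper G c proper free zero) zero
    (recolor-unused G c proper free zero)))
  1+n≰n
  where
  free : ∀ v → ∃ (FreeColor G c v)
  free v = decidable-stable (any? (freeColor? G c v)) λ ¬free → none (v , ¬free)

noFreeColor⇒determining : ∀ {n} (G : Graph n) (c : Fin n → Fin (χ G)) v →
                          ¬ ∃ (FreeColor G c v) → Determining G c (⊤ - v)
noFreeColor⇒determining G c v ¬free c′ proper′ agree = agree-everywhere
  where
  agree-off : ∀ {u} → u ≢ v → c′ u ≡ c u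
  agree-off u≢v = agree (x∈p∧x≢y⇒x∈p-y ∈⊤ u≢v)

  -- A different value `c′ v` would be free for `v` under `c`: neighbors of `v` differ from `v`, so
  -- `c′` and `c` agree on them, and `c′` is proper.
  agree-at : c′ v ≡ c v
  agree-at = decidable-stable (c′ v ≟ c v) λ c′v≢cv → ¬free
    (c′ v , c′v≢cv , λ u v~u c′v≡cu →
      proper′ v u v~u
        (trans c′v≡cu (sym (agree-off λ u≡v → Graph.~-irrefl G (sym u≡v) v~u))))

  agree-everywhere : ∀ u → c′ u ≡ c u
  agree-everywhere u with u ≟ v
  ... | yes refl = agree-at
  ... | no  u≢v  = agree-off u≢v

⊤-not-critical : ∀ {n} (G : Graph (suc n)) (c : Fin (suc n) → Fin (χ G)) →
                 Proper G c → ¬ Critical G c ⊤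
⊤-not-critical G c proper (_ , minimal)
  with v , ¬free ← ∃-noFreeColor G (proj₂ (χ-isChromaticNumber G)) c proper zero
  = minimal (⊤ - v) (x∈p⇒p-x⊂p ∈⊤) (noFreeColor⇒determining G c v ¬free)

proposition4 : (n : ℕ) .{{_ : NonZero n}} (G : Graph n)
    (c : Fin n → Fin (χ G)) → Proper G c →
    (S : Subset n) → Critical G c S → ∣ S ∣ ≤ n ∸ 1
proposition4 (suc n) G c proper S critical with ∣ S ∣ ℕ.≟ suc n
... | no  ∣S∣≢n = s≤s⁻¹ (≤∧≢⇒< (∣p∣≤n S) ∣S∣≢n)
-- Only the full vertex set has `suc n` elements.
... | yes ∣S∣≡n with refl ← ∣p∣≡n⇒p≡⊤ {p = S} ∣S∣≡n =
  contradiction critical (⊤-not-critical G c proper)
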